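{- The emptiness problem for register set automata with removal and register emptiness test is undecidable.
   Context: Fix a finite nonempty alphabet $\Sigma$ and an infinite data domain $\mathbb{D}$. A register set automaton with removal and register emptiness test is a tuple $(Q,R,\Delta,I,F)$ with $Q$ finite states, $R$ finite registers, $I,F\subseteq Q$, and transitions $q\xrightarrow{a\mid G^{\in},G^{\notin},G^{\emptyset},Rem,up}s$ with $a\in\Sigma$, $G^{\in},G^{\notin},G^{\emptyset},Rem\subseteq R$, and $up\colon R\to 2^{R\cup\{\mathit{in}\}}$. Configurations are $(q,f)$ with $f\colon R\to 2^{\mathbb{D}}$; initial ones have $q\in I$ and all registers empty. A step over $(a,d)\in\Sigma\times\mathbb{D}$ is possible iff $d\in f(r)$ for all $r\in G^{\in}$, $d\notin f(r)$ for all $r\in G^{\notin}$, and $f(r)=\emptyset$ for all $r\in G^{\emptyset}$; the registers are then updated by removing $d$ from each register in $Rem$ and setting each register $r$ to $\bigcup\{x\mid x\in up(r)\}$ (the union of the contents of the registers in $up(r)$, together with $d$ if $\mathit{in}\in up(r)$). The language is the set of words in $(\Sigma\times\mathbb{D})^*$ with a run from an initial configuration ending in $F$; the emptiness problem asks whether this language is empty. -}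

module Defs where

open import Data.Nat using (ℕ; zero; suc)
open import Data.Fin as Fin using (Fin; zero; suc; fromℕ)
open import Data.Bool using (Bool; true; false; _∧_; _∨_; not)
open import Data.List as List using (List)
open import Data.List.Membership.Propositional using (_∈_)
open import Data.Product using (proj₁; Σ; _×_; _,_; ∃; ∃-syntax)
open import Relation.Binary.PropositionalEquality using (_≡_)
open import Relation.Binary.Definitions using (DecidableEquality)
open import Relation.Nullary.Decidable using (⌊_⌋)

anyFin : ∀ {n} → (Fin n → Bool) → Bool
anyFin {zero}  p = false
anyFin {suc n} p = p zero ∨ anyFin (λ i → p (suc i))

record Transition (Sig : Set) (nQ nR : ℕ) : Set where
  field
    src    : Fin nQ
    letter : Sig
    Gin    : Fin nR → Bool
    Gnotin : Fin nR → Bool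
    Gempty : Fin nR → Bool
    Rem    : Fin nR → Bool
    upReg  : Fin nR → Fin nR → Bool -- upReg r r' = true  iff  r' ∈ up(r)
    upIn   : Fin nR → Bool          -- upIn r = true      iff  in ∈ up(r)
    tgt    : Fin nQ

record RSA (Sig : Set) : Set where
  field
    nQ    : ℕ
    nR    : ℕ
    Δ     : List (Transition Sig nQ nR)
    Init  : Fin nQ → Bool
    Final : Fin nQ → Bool

module Semantics (D : Set) (_≟_ : DecidableEquality D) {Sig : Set} (A : RSA Sig) where
  open RSA A

  Val : Set
  Val = Fin nR → D → Bool

  emptyVal : Val
  emptyVal r x = false

  Config : Set
  Config = Fin nQ × Val

  Enabled : Transition Sig nQ nR → Val → D → Set
  Enabled t f d =
    (∀ r → Transition.Gin t r ≡ true → f r d ≡ true) ×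
    (∀ r → Transition.Gnotin t r ≡ true → f r d ≡ false) ×
    (∀ r → Transition.Gempty t r ≡ true → ∀ x → f r x ≡ false)

  -- removal of d from the registers in Rem, then the update
  -- r ↦ ⋃ { x | x ∈ up(r) }
  removed : Transition Sig nQ nR → Val → D → Val
  removed t f d r x = f r x ∧ not (Transition.Rem t r ∧ ⌊ x ≟ d ⌋)

  update : Transition Sig nQ nR → Val → D → Val
  update t f d r x =
    (Transition.upIn t r ∧ ⌊ x ≟ d ⌋) ∨
    anyFin (λ r' → Transition.upReg t r r' ∧ removed t f d r' x)

  data Step : Config → Sig × D → Config → Set where
    step : ∀ {f} {d} (t : Transition Sig nQ nR) → t ∈ Δ → Enabled t f d →
           Step (Transition.src t , f) (Transition.letter t , d)
                (Transition.tgt t , update t f d)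

  data Run : Config → List (Sig × D) → Config → Set where
    done : ∀ {c} → Run c List.[] c
    next : ∀ {c c' c'' ad w} → Step c ad c' → Run c' w c'' →
           Run c (ad List.∷ w) c''

  Accepts : List (Sig × D) → Set
  Accepts w = ∃[ q₀ ] Init q₀ ≡ true ×
              ∃[ c ] Run (q₀ , emptyVal) w c × Final (proj₁ c) ≡ true

  NonEmpty : Set
  NonEmpty = ∃[ w ] Accepts w

-- A machine with n instructions; program counter in Fin (suc n);
-- the counter value n (= fromℕ n) is the halting location.

data Instr (n : ℕ) : Set where
  inc : Fin 2 → Fin (suc n) → Instr n
  dec : Fin 2 → Fin (suc n) → Fin (suc n) → Instr n -- if c = 0 goto j else c-- ; goto k

record Minsky : Set where
  field
    size : ℕ
    prog : Fin size → Instr size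

module MinskySem (M : Minsky) where
  open Minsky M

  MConfig : Set
  MConfig = Fin (suc size) × (Fin 2 → ℕ)

  setC : (Fin 2 → ℕ) → Fin 2 → ℕ → (Fin 2 → ℕ)
  setC v zero    m zero    = m
  setC v zero    m (suc i) = v (suc i)
  setC v (suc c) m zero    = v zero
  setC v (suc c) m (suc i) = m

  data MStep : MConfig → MConfig → Set where
    s-inc  : ∀ {i c j v} → prog i ≡ inc c j →
             MStep (Fin.inject₁ i , v) (j , setC v c (suc (v c)))
    s-zero : ∀ {i c j k v} → prog i ≡ dec c j k → v c ≡ 0 →
             MStep (Fin.inject₁ i , v) (j , v)
    s-dec  : ∀ {i c j k v m} → prog i ≡ dec c j k → v c ≡ suc m →
             MStep (Fin.inject₁ i , v) (k , setC v c m)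

  data Reach : MConfig → MConfig → Set where
    here  : ∀ {c} → Reach c c
    there : ∀ {c c' c''} → MStep c c' → Reach c' c'' → Reach c c''

  Halts : Set
  Halts = ∃[ v ] Reach (Fin.zero , λ _ → 0) (fromℕ size , v)

-- A two-counter machine is simulated with one automaton state per program
-- location and one register per counter, the counter value being the number of
-- data values stored in the register: an increment reads a datum absent from the
-- register (G^∉) and adds it, a decrement reads a datum present in it (G^∈) and
-- removes it, and a zero test is the emptiness guard G^∅. An accepting run thus
-- projects to a halting computation, under the invariant that each register has
-- as many elements as its counter. Conversely a halting computation is replayed
-- with ι N as the datum of the next step, where no register contains any ι n
-- with n ≥ N; injectivity of ι keeps this true after ι N is used and N grows.

{-# OPTIONS --safe #-}
module Submission where

open import Defs
open import Data.Nat using (ℕ; suc)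
open import Data.Fin using (Fin)
open import Data.Product using (Σ-syntax)
open import Relation.Binary.Definitions using (DecidableEquality)
open import Function.Bundles using (_↣_; _⇔_)

open import Data.Bool using (Bool; true; false; _∧_; _∨_; not)
open import Data.Bool.Properties using (∧-identityʳ; ∧-zeroʳ; ∨-identityʳ)
open import Data.Empty using (⊥-elim)
open import Data.Fin as Fin using (zero; suc; fromℕ; inject₁)
open import Data.List using (List; []; _∷_; concatMap; allFin)
open import Data.List.Membership.Propositional using (_∈_; lose)
open import Data.List.Membership.Propositional.Properties
  using (∈-concatMap⁺; ∈-concatMap⁻; ∈-allFin)
open import Data.List.Relation.Unary.Any using (here; there; satisfied)
open import Data.Nat using (_≤_)
open import Data.Nat.Properties using (≤-refl; ≤-trans; n≤1+n; <-irrefl)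
open import Data.Product using (_,_; ∃-syntax; map₂)
open import Function.Base using (_∘_)
open import Function.Bundles using (Injection; mk⇔)
open import Relation.Binary.PropositionalEquality
open import Relation.Nullary using (Dec; yes; no; does; ¬_)
open import Relation.Nullary.Decidable using (⌊_⌋; dec-true; dec-false; isYes≗does)

true≢false : true ≢ false
true≢false ()

⌊⌋-yes : ∀ {A : Set} (a? : Dec A) → A → ⌊ a? ⌋ ≡ true
⌊⌋-yes a? a = trans (isYes≗does a?) (dec-true a? a)

⌊⌋-no : ∀ {A : Set} (a? : Dec A) → ¬ A → ⌊ a? ⌋ ≡ false
⌊⌋-no a? ¬a = trans (isYes≗does a?) (dec-false a? ¬a)

does-true⇒ : ∀ {A : Set} (a? : Dec A) → does a? ≡ true → A
does-true⇒ (yes a) _ = a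

-- Using does rather than ⌊_⌋ lets only (suc c) (suc r) reduce to only c r,
-- since Fin's _≟_ goes through map′ on successors.
only : ∀ {n} → Fin n → Fin n → Bool
only c r = does (r Fin.≟ c)

only-self : ∀ {n} (c : Fin n) → only c c ≡ true
only-self c = dec-true (c Fin.≟ c) refl

only-other : ∀ {n} {c r : Fin n} → r ≢ c → only c r ≡ false
only-other {c = c} {r} = dec-false (r Fin.≟ c)

only-guard : ∀ {n} (P : Fin n → Set) {c} → P c → ∀ r → only c r ≡ true → P r
only-guard P {c} pc r e = subst P (sym (does-true⇒ (r Fin.≟ c) e)) pc

anyFin-false : ∀ n → anyFin {n} (λ _ → false) ≡ false
anyFin-false 0       = refl
anyFin-false (suc n) = anyFin-false n

anyFin-only : ∀ {n} (r : Fin n) (g : Fin n → Bool) →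
              anyFin (λ r' → only r r' ∧ g r') ≡ g r
anyFin-only {suc n} zero    g = trans (cong (g zero ∨_) (anyFin-false n)) (∨-identityʳ (g zero))
anyFin-only {suc n} (suc r) g = anyFin-only r (g ∘ suc)

module Cardinality {D : Set} (_≟_ : DecidableEquality D) where

  infix 4 _≐_
  _≐_ : (D → Bool) → (D → Bool) → Set
  g ≐ h = ∀ x → g x ≡ h x

  insert : D → (D → Bool) → D → Bool
  insert d g x = ⌊ x ≟ d ⌋ ∨ g x

  delete : D → (D → Bool) → D → Bool
  delete d g x = g x ∧ not ⌊ x ≟ d ⌋

  insert-self : ∀ {g h d} → g ≐ insert d h → g d ≡ true
  insert-self {h = h} {d} g≐ = trans (g≐ d) (cong (_∨ h d) (⌊⌋-yes (d ≟ d) refl))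

  insert-other : ∀ {g h d x} → g ≐ insert d h → x ≢ d → g x ≡ h x
  insert-other {h = h} {d} {x} g≐ x≢d = trans (g≐ x) (cong (_∨ h x) (⌊⌋-no (x ≟ d) x≢d))

  delete-insert : ∀ {g h d} → h d ≡ false → g ≐ insert d h → delete d g ≐ h
  delete-insert {g} {h} {d} hd g≐ x with x ≟ d
  ... | yes refl = trans (∧-zeroʳ (g x)) (sym hd)
  ... | no x≢d  = trans (∧-identityʳ (g x)) (insert-other g≐ x≢d)

  delete-insert-comm : ∀ {g h d e} → e ≢ d → g ≐ insert d h →
                       delete e g ≐ insert d (delete e h)
  delete-insert-comm {g} {h} {d} {e} e≢d g≐ x with x ≟ d
  ... | yes refl = cong₂ (λ a b → a ∧ not b) (insert-self g≐) (⌊⌋-no (x ≟ e) (e≢d ∘ sym))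
  ... | no x≢d  = cong (_∧ not ⌊ x ≟ e ⌋) (insert-other g≐ x≢d)

  data HasSize : (D → Bool) → ℕ → Set where
    size-∅      : ∀ {g} → (∀ x → g x ≡ false) → HasSize g 0
    size-insert : ∀ {g h n} d → h d ≡ false → g ≐ insert d h → HasSize h n →
                  HasSize g (suc n)

  HasSize-resp : ∀ {g h n} → g ≐ h → HasSize h n → HasSize g n
  HasSize-resp g≐h (size-∅ h∅)                 = size-∅ (λ x → trans (g≐h x) (h∅ x))
  HasSize-resp g≐h (size-insert d hd h≐ size) =
    size-insert d hd (λ x → trans (g≐h x) (h≐ x)) size

  HasSize-0⇒empty : ∀ {g} → HasSize g 0 → ∀ x → g x ≡ false
  HasSize-0⇒empty (size-∅ g∅) = g∅

  empty⇒HasSize-0 : ∀ {g n} → (∀ x → g x ≡ false) → HasSize g n → n ≡ 0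
  empty⇒HasSize-0 g∅ (size-∅ _)               = refl
  empty⇒HasSize-0 g∅ (size-insert d _ g≐ _) =
    ⊥-elim (true≢false (trans (sym (insert-self g≐)) (g∅ d)))

  member⇒HasSize-suc : ∀ {g n e} → HasSize g n → g e ≡ true → ∃[ m ] n ≡ suc m
  member⇒HasSize-suc (size-∅ g∅)             ge = ⊥-elim (true≢false (trans (sym ge) (g∅ _)))
  member⇒HasSize-suc (size-insert _ _ _ _) _  = _ , refl

  HasSize-suc⇒member : ∀ {g n} → HasSize g (suc n) → ∃[ d ] g d ≡ true
  HasSize-suc⇒member (size-insert d _ g≐ _) = d , insert-self g≐

  HasSize-delete : ∀ {g n e} → HasSize g (suc n) → g e ≡ true → HasSize (delete e g) n
  HasSize-delete {e = e} (size-insert d hd g≐ size) ge with e ≟ d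
  ... | yes refl = HasSize-resp (delete-insert hd g≐) size
  ... | no e≢d
    with h∋e ← trans (sym (insert-other g≐ e≢d)) ge
    with _ , refl ← member⇒HasSize-suc size h∋e
    = size-insert d (cong (_∧ _) hd) (delete-insert-comm e≢d g≐) (HasSize-delete size h∋e)

module DiagonalUpdate (D : Set) (_≟_ : DecidableEquality D) {Sig : Set} (A : RSA Sig) where
  open Semantics D _≟_ A
  open Cardinality _≟_
  open Transition

  update-diagonal : ∀ t f d r x → upReg t ≡ only →
                    update t f d r x ≡ (upIn t r ∧ ⌊ x ≟ d ⌋) ∨ removed t f d r x
  update-diagonal t f d r x up rewrite up = cong (_ ∨_) (anyFin-only r (λ r' → removed t f d r' x))

  update-keeps : ∀ t f d r → upReg t ≡ only → upIn t r ≡ false → Rem t r ≡ false →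
                 update t f d r ≐ f r
  update-keeps t f d r up noIn noRem x rewrite update-diagonal t f d r x up | noIn | noRem =
    ∧-identityʳ (f r x)

  update-inserts : ∀ t f d r → upReg t ≡ only → upIn t r ≡ true → Rem t r ≡ false →
                   update t f d r ≐ insert d (f r)
  update-inserts t f d r up isIn noRem x rewrite update-diagonal t f d r x up | isIn | noRem =
    cong (_ ∨_) (∧-identityʳ (f r x))

  update-deletes : ∀ t f d r → upReg t ≡ only → upIn t r ≡ false → Rem t r ≡ true →
                   update t f d r ≐ delete d (f r)
  update-deletes t f d r up noIn isRem x rewrite update-diagonal t f d r x up | noIn | isRem =
    refl

  update-fresh : ∀ t f d r x → upReg t ≡ only → f r x ≡ false → ⌊ x ≟ d ⌋ ≡ false →
                 update t f d r x ≡ false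
  update-fresh t f d r x up fx x≢d rewrite update-diagonal t f d r x up | fx | x≢d =
    trans (∨-identityʳ _) (∧-zeroʳ (upIn t r))

module Construction (k : ℕ) (M : Minsky) where
  open Minsky M

  Tr : Set
  Tr = Transition (Fin (suc k)) (suc size) 2

  nowhere : Fin 2 → Bool
  nowhere _ = false

  idle : Fin (suc size) → Fin (suc size) → Tr
  idle q q' = record { src = q ; letter = zero ; Gin = nowhere ; Gnotin = nowhere ; Gempty = nowhere
                     ; Rem = nowhere ; upReg = only ; upIn = nowhere ; tgt = q' }

  incT : Fin size → Fin 2 → Fin (suc size) → Tr
  incT i c j = record (idle (inject₁ i) j) { Gnotin = only c ; upIn = only c }

  zeroT : Fin size → Fin 2 → Fin (suc size) → Tr
  zeroT i c j = record (idle (inject₁ i) j) { Gempty = only c }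

  decT : Fin size → Fin 2 → Fin (suc size) → Tr
  decT i c l = record (idle (inject₁ i) l) { Gin = only c ; Rem = only c }

  transitionsOf : Fin size → Instr size → List Tr
  transitionsOf i (inc c j)   = incT i c j ∷ []
  transitionsOf i (dec c j l) = zeroT i c j ∷ decT i c l ∷ []

  transitions : List Tr
  transitions = concatMap (λ i → transitionsOf i (prog i)) (allFin size)

  automaton : RSA (Fin (suc k))
  automaton = record { nQ = suc size ; nR = 2 ; Δ = transitions
                     ; Init = only zero ; Final = only (fromℕ size) }

  ∈-transitions : ∀ {t i ins} → prog i ≡ ins → t ∈ transitionsOf i ins → t ∈ transitions
  ∈-transitions {i = i} refl t∈ =
    ∈-concatMap⁺ (λ i → transitionsOf i (prog i)) (lose (∈-allFin i) t∈)

  data Implements : Tr → Set where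
    implements-inc  : ∀ {i c j}   → prog i ≡ inc c j   → Implements (incT i c j)
    implements-zero : ∀ {i c j l} → prog i ≡ dec c j l → Implements (zeroT i c j)
    implements-dec  : ∀ {i c j l} → prog i ≡ dec c j l → Implements (decT i c l)

  transitions-implement : ∀ {t} → t ∈ transitions → Implements t
  transitions-implement t∈
    with i , t∈ᵢ ← satisfied (∈-concatMap⁻ (λ i → transitionsOf i (prog i)) {xs = allFin size} t∈)
    = of-instruction (prog i) refl t∈ᵢ
    where
    of-instruction : ∀ {t} ins → prog i ≡ ins → t ∈ transitionsOf i ins → Implements t
    of-instruction (inc c j)   eq (here refl)         = implements-inc eq
    of-instruction (dec c j l) eq (here refl)         = implements-zero eq
    of-instruction (dec c j l) eq (there (here refl)) = implements-dec eq

module Correctness (D : Set) (_≟_ : DecidableEquality D) (ι : ℕ ↣ D) (k : ℕ) (M : Minsky) where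
  open Minsky M
  open MinskySem M
  open Construction k M
  open Semantics D _≟_ automaton
  open DiagonalUpdate D _≟_ automaton
  open Cardinality _≟_

  setC-elim : ∀ (P : Fin 2 → ℕ → Set) {v c m} → P c m → (∀ r → r ≢ c → P r (v r)) →
              ∀ r → P r (setC v c m r)
  setC-elim P {c = zero}     pc other zero       = pc
  setC-elim P {c = zero}     pc other (suc zero) = other (suc zero) λ ()
  setC-elim P {c = suc zero} pc other zero       = other zero λ ()
  setC-elim P {c = suc zero} pc other (suc zero) = pc

  Represents : Val → (Fin 2 → ℕ) → Set
  Represents f v = ∀ r → HasSize (f r) (v r)

  represents-∅ : Represents emptyVal (λ _ → 0)
  represents-∅ r = size-∅ (λ _ → refl)

  represents-inc : ∀ i c j {f v d} → Represents f v → f c d ≡ false →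
                   Represents (update (incT i c j) f d) (setC v c (suc (v c)))
  represents-inc i c j {f} {d = d} rep fd =
    setC-elim (λ r n → HasSize (update t f d r) n)
      (size-insert d fd (update-inserts t f d c refl (only-self c) refl) (rep c))
      (λ r r≢c → HasSize-resp (update-keeps t f d r refl (only-other r≢c) refl) (rep r))
    where t = incT i c j

  represents-zero : ∀ i c j {f v d} → Represents f v → Represents (update (zeroT i c j) f d) v
  represents-zero i c j {f} {d = d} rep r =
    HasSize-resp (update-keeps (zeroT i c j) f d r refl refl refl) (rep r)

  represents-dec : ∀ i c l {f v d m} → Represents f v → f c d ≡ true → v c ≡ suc m →
                   Represents (update (decT i c l) f d) (setC v c m)
  represents-dec i c l {f} {d = d} rep fd vc =
    setC-elim (λ r n → HasSize (update t f d r) n)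
      (HasSize-resp (update-deletes t f d c refl refl (only-self c))
        (HasSize-delete (subst (HasSize (f c)) vc (rep c)) fd))
      (λ r r≢c → HasSize-resp (update-keeps t f d r refl refl (only-other r≢c)) (rep r))
    where t = decT i c l

  run⇒reach : ∀ {q f w q' f' v} → Run (q , f) w (q' , f') → Represents f v →
              only (fromℕ size) q' ≡ true → ∃[ v' ] Reach (q , v) (fromℕ size , v')
  run⇒reach {q = q} done _ final with refl ← does-true⇒ (q Fin.≟ fromℕ size) final = _ , here
  run⇒reach (next (step {d = d} t t∈ (in-guard , notin-guard , empty-guard)) run) rep final
    with transitions-implement t∈
  ... | implements-inc {i} {c} {j} eq =
    map₂ (there (s-inc eq))
         (run⇒reach run (represents-inc i c j rep (notin-guard c (only-self c))) final)
  ... | implements-zero {i} {c} {j} eq =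
    map₂ (there (s-zero eq (empty⇒HasSize-0 (empty-guard c (only-self c)) (rep c))))
         (run⇒reach run (represents-zero i c j {d = d} rep) final)
  ... | implements-dec {i} {c} {l = l} eq
    with _ , vc ← member⇒HasSize-suc (rep c) (in-guard c (only-self c)) =
    map₂ (there (s-dec eq vc))
         (run⇒reach run (represents-dec i c l rep (in-guard c (only-self c)) vc) final)

  inj : ℕ → D
  inj = Injection.to ι

  FreshFrom : Val → ℕ → Set
  FreshFrom f N = ∀ r n → N ≤ n → f r (inj n) ≡ false

  fresh-update : ∀ t f {d N N'} → Transition.upReg t ≡ only → FreshFrom f N → N ≤ N' →
                 (∀ n → N' ≤ n → inj n ≢ d) → FreshFrom (update t f d) N'
  fresh-update t f {d} up fresh N≤N' avoids r n N'≤n =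
    update-fresh t f d r (inj n) up (fresh r n (≤-trans N≤N' N'≤n))
                 (⌊⌋-no (inj n ≟ d) (avoids n N'≤n))

  fresh-update-new : ∀ t f {N} → Transition.upReg t ≡ only → FreshFrom f N →
                     FreshFrom (update t f (inj N)) (suc N)
  fresh-update-new t f up fresh =
    fresh-update t f up fresh (n≤1+n _) (λ n N<n e → <-irrefl (sym (Injection.injective ι e)) N<n)

  fresh-update-stored : ∀ t f {d N c} → Transition.upReg t ≡ only → FreshFrom f N → f c d ≡ true →
                        FreshFrom (update t f d) N
  fresh-update-stored t f {c = c} up fresh fd = fresh-update t f up fresh ≤-refl
    λ n N≤n e → true≢false (trans (sym fd) (trans (cong (f c) (sym e)) (fresh c n N≤n)))

  RunsTo : Config → Fin (suc size) → Set
  RunsTo c q' = ∃[ w ] ∃[ f' ] Run c w (q' , f')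

  prepend : ∀ {c ad c' q'} → Step c ad c' → RunsTo c' q' → RunsTo c q'
  prepend s (w , f' , run) = _ , f' , next s run

  reach⇒run : ∀ {q v q' v' f N} → Reach (q , v) (q' , v') → Represents f v → FreshFrom f N →
              RunsTo (q , f) q'
  reach⇒run here _ _ = [] , _ , done
  reach⇒run {f = f} {N} (there (s-inc {i} {c} {j} eq) reach) rep fresh =
    prepend (step (incT i c j) (∈-transitions eq (here refl)) enabled)
      (reach⇒run reach (represents-inc i c j rep (fresh c N ≤-refl))
                        (fresh-update-new (incT i c j) f refl fresh))
    where
    enabled : Enabled (incT i c j) f (inj N)
    enabled = (λ _ ()) , only-guard (λ r → f r (inj N) ≡ false) (fresh c N ≤-refl) , (λ _ ())
  reach⇒run {f = f} {N} (there (s-zero {i} {c} {j} eq vz) reach) rep fresh =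
    prepend (step (zeroT i c j) (∈-transitions eq (here refl)) enabled)
      (reach⇒run reach (represents-zero i c j {d = inj N} rep)
                        (fresh-update-new (zeroT i c j) f refl fresh))
    where
    enabled : Enabled (zeroT i c j) f (inj N)
    enabled = (λ _ ()) , (λ _ ()) ,
              only-guard (λ r → ∀ x → f r x ≡ false)
                         (HasSize-0⇒empty (subst (HasSize (f c)) vz (rep c)))
  reach⇒run {f = f} (there (s-dec {i} {c} {k = l} eq vc) reach) rep fresh
    with d , fd ← HasSize-suc⇒member (subst (HasSize (f c)) vc (rep c)) =
    prepend (step (decT i c l) (∈-transitions eq (there (here refl))) enabled)
      (reach⇒run reach (represents-dec i c l rep fd vc)
                        (fresh-update-stored (decT i c l) f refl fresh fd))
    where
    enabled : Enabled (decT i c l) f d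
    enabled = only-guard (λ r → f r d ≡ true) fd , (λ _ ()) , (λ _ ())

  halts⇔nonEmpty : Halts ⇔ NonEmpty
  halts⇔nonEmpty = mk⇔ halts⇒nonEmpty nonEmpty⇒halts
    where
    halts⇒nonEmpty : Halts → NonEmpty
    halts⇒nonEmpty (_ , reach)
      with w , f , run ← reach⇒run {N = 0} reach represents-∅ (λ _ _ _ → refl)
      = w , zero , refl , (fromℕ size , f) , run , only-self (fromℕ size)

    nonEmpty⇒halts : NonEmpty → Halts
    nonEmpty⇒halts (_ , q₀ , initial , _ , run , final)
      with refl ← does-true⇒ (q₀ Fin.≟ zero) initial
      = run⇒reach run represents-∅ final

theorem7p3 : (D : Set) (_≟_ : DecidableEquality D) → (ℕ ↣ D) → (k : ℕ) →
    Σ[ red ∈ (Minsky → RSA (Fin (suc k))) ]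
      (∀ M → MinskySem.Halts M ⇔ Semantics.NonEmpty D _≟_ (red M))
theorem7p3 D _≟_ ι k = Construction.automaton k , Correctness.halts⇔nonEmpty D _≟_ ι k
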